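{- For every $n\ge1$, the procedure $p\mapsto T(p)$ is a bijection from the set of 213-avoiding permutations of $\{1,\dots,n\}$ to the set of binary trees with $n+1$ leaves.
   Context: A permutation $p=(m_1,\dots,m_n)$ of $\{1,\dots,n\}$ is 213-avoiding if there are no indices $i<j<k$ with $m_j<m_i<m_k$. A binary tree is a finite planar rooted tree in which every internal node has exactly two children (a left child and a right child). Procedure. Given a finite sequence $p=(\phi_1,\dots,\phi_n)$ of distinct integers (213-avoiding), define the binary tree $T(p)$ with $n+1$ leaves recursively. If $p$ is empty, $T(p)$ is a single leaf. Otherwise let $\phi_a$ be the smallest term of $p$, let $y=(\phi_1,\dots,\phi_{a-1})$ be the sequence of terms before it and $x=(\phi_{a+1},\dots,\phi_n)$ the sequence of terms after it; then $T(p)$ is the tree whose root has left subtree $T(x)$ (with $|x|+1$ leaves) and right subtree $T(y)$ (with $|y|+1$ leaves). (In a picture with root at $(0,0)$ and leaves at $(n,0),(n-1,1),\dots,(0,n)$ from left to right, one draws the ascending line from $(n,0)$ to $(0,0)$, the descending line from $(0,0)$ to $(0,n)$, the ascending line from $(|y|,n-|y|)$ to $(0,n-|y|)$ and the descending line from $(n-|x|,0)$ to $(n-|x|,|x|)$, and repeats in the two subtrees.) -}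

module Defs where

open import Data.Fin.Base as Fin using (Fin)
open import Data.Integer.Base using (ℤ; +_; _<_; _≤_)
open import Data.Integer.Properties
  using (_≤?_; ≤-trans; <⇒≤; ≰⇒>)
open import Data.List.Base using (List; []; _∷_; _++_; length; lookup; applyUpTo)
open import Data.List.Properties using (length-++; length-applyUpTo)
open import Data.List.Relation.Binary.Permutation.Propositional using (_↭_)
open import Data.List.Relation.Binary.Permutation.Propositional.Properties using (↭-length)
open import Data.List.Relation.Unary.All as All using (All; []; _∷_)
import Data.Nat.Base as ℕ
open ℕ using (ℕ; suc)
open import Data.Nat.Induction using (Acc; acc; <-wellFounded)
import Data.Nat.Properties as ℕₚ
open import Data.Product.Base using (_×_)
open import Data.Tree.Binary using (Tree; leaf; node; #leaves)
open import Data.Unit.Base using (⊤; tt)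
open import Relation.Binary.PropositionalEquality
  using (_≡_; refl; sym; trans; cong; cong₂)
open import Relation.Nullary using (¬_; yes; no)

-- The terms of a finite sequence p are numbered from 0: lookup p i is the
-- term of index i + 1 in the usual notation.

Avoids213 : List ℤ → Set
Avoids213 p = (i j k : Fin (length p)) → i Fin.< j → j Fin.< k →
  ¬ (lookup p j < lookup p i × lookup p i < lookup p k)

-- A permutation of {1,…,n} in one-line notation is a rearrangement of the
-- list 1 , 2 , … , n.

IsPermutation : ℕ → List ℤ → Set
IsPermutation n p = p ↭ applyUpTo (λ i → + suc i) n

record AvoidingPermutation (n : ℕ) : Set where
  constructor mkAvoiding
  field
    seq    : List ℤ
    isPerm : IsPermutation n seq
    avoids : Avoids213 seq

open AvoidingPermutation public

-- Equality of permutations is equality of the sequences; the evidence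
-- carried along is not compared.

infix 4 _≈ₚ_

_≈ₚ_ : ∀ {n} → AvoidingPermutation n → AvoidingPermutation n → Set
p ≈ₚ q = seq p ≡ seq q

-- Unlabelled trees: the labels are trivial.

BinaryTree : Set
BinaryTree = Tree ⊤ ⊤

record BinaryTreeWithLeaves (m : ℕ) : Set where
  constructor mkTree
  field
    tree   : BinaryTree
    leaves : #leaves tree ≡ m

open BinaryTreeWithLeaves public

infix 4 _≈ₜ_

_≈ₜ_ : ∀ {m} → BinaryTreeWithLeaves m → BinaryTreeWithLeaves m → Set
s ≈ₜ t = tree s ≡ tree t

-- SplitAtMin p says that p is empty, or is y ++ φ ∷ x with φ the smallest
-- term of p. When terms repeat, φ is the first smallest one; for distinct
-- terms there is nothing to choose.

data SplitAtMin : List ℤ → Set where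
  empty : SplitAtMin []
  split : ∀ y φ x → All (φ <_) y → All (φ ≤_) x → SplitAtMin (y ++ φ ∷ x)

splitAtMin : ∀ p → SplitAtMin p
splitAtMin []      = empty
splitAtMin (a ∷ p) with splitAtMin p
... | empty = split [] a [] [] []
... | split y φ x φ<y φ≤x with a ≤? φ
...   | yes a≤φ = split [] a (y ++ φ ∷ x) [] (below y φ<y)
  where
  below : ∀ z → All (φ <_) z → All (a ≤_) (z ++ φ ∷ x)
  below []      []          = a≤φ ∷ All.map (≤-trans a≤φ) φ≤x
  below (_ ∷ z) (φ<b ∷ φ<z) = ≤-trans a≤φ (<⇒≤ φ<b) ∷ below z φ<z
...   | no  a≰φ = split (a ∷ y) φ x (≰⇒> a≰φ ∷ φ<y) φ≤x

length-before : ∀ y (φ : ℤ) x → length y ℕ.< length (y ++ φ ∷ x)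
length-before y φ x rewrite length-++ y {φ ∷ x} = ℕₚ.m<m+n (length y) ℕ.z<s

length-after : ∀ y (φ : ℤ) x → length x ℕ.< length (y ++ φ ∷ x)
length-after y φ x rewrite length-++ y {φ ∷ x} = ℕₚ.m≤n+m (suc (length x)) (length y)

-- The recursion is on the length of the sequence. The terms after the
-- smallest one give the left subtree, those before it the right subtree.

buildTree : ∀ p → Acc ℕ._<_ (length p) → BinaryTree
buildTree p rec with splitAtMin p
buildTree .[]           _         | empty         = leaf tt
buildTree .(y ++ φ ∷ x) (acc rec) | split y φ x _ _ =
  node (buildTree x (rec (length-after y φ x))) tt
       (buildTree y (rec (length-before y φ x)))

T : List ℤ → BinaryTree
T p = buildTree p (<-wellFounded (length p))

#leaves-buildTree : ∀ p (rec : Acc ℕ._<_ (length p)) →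
                    #leaves (buildTree p rec) ≡ suc (length p)
#leaves-buildTree p rec with splitAtMin p
#leaves-buildTree .[]           _         | empty         = refl
#leaves-buildTree .(y ++ φ ∷ x) (acc rec) | split y φ x _ _ =
  trans (cong₂ ℕ._+_ (#leaves-buildTree x _) (#leaves-buildTree y _))
  (trans (ℕₚ.+-comm (suc (length x)) (suc (length y)))
         (cong suc (sym (length-++ y))))

treeOf : ∀ {n} → AvoidingPermutation n → BinaryTreeWithLeaves (suc n)
treeOf {n} p = mkTree (T (seq p))
  (trans (#leaves-buildTree (seq p) _)
         (cong suc (trans (↭-length (isPerm p)) (length-applyUpTo _ n))))

{-# OPTIONS --safe #-}

-- In y ++ φ ∷ x with φ the smallest term, a term of y below a term of x would
-- form a 213 pattern with φ between them. So a 213-avoiding rearrangement of an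
-- interval has its smallest label k at the root, the labels just above k in the
-- left subtree T(x) and the remaining, larger ones in the right subtree T(y).
-- The labels can therefore be put back on a bare tree, and this inverts T.

module Submission where

open import Defs
open import Data.Nat.Base using (ℕ; suc; _≥_)
open import Function.Definitions using (Bijective)

open import Data.Fin.Base as Fin using (zero; suc)
open import Data.Integer.Base using (ℤ; +_; _<_; _≤_; +<+; +≤+)
open import Data.Integer.Properties as ℤₚ
  using (≤⇒≯; ≮⇒≥; <⇒≤; <-≤-trans; ≤-decTotalOrder; ≤-totalOrder)
open import Data.List.Base
  using (List; []; _∷_; _++_; length; lookup; applyUpTo)
open import Data.List.Properties
  using (∷-injective; length-++; tabulate-lookup)
open import Data.List.Membership.Propositional.Properties using (∈-lookup)
open import Data.List.Relation.Binary.Permutation.Propositional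
  using (_↭_; ↭-refl; ↭-sym; ↭-trans; ↭-prep; ↭-reflexive; ↭⇒↭ₛ)
open import Data.List.Relation.Binary.Permutation.Propositional.Properties
  using (All-resp-↭; ++-comm; ++⁺; ↭-length)
open import Data.List.Relation.Binary.Pointwise using (Pointwise-≡⇒≡)
open import Data.List.Relation.Unary.All as All using (All; []; _∷_)
import Data.List.Relation.Unary.All.Properties as Allₚ
open import Data.List.Relation.Unary.AllPairs as AllPairs using (AllPairs; []; _∷_)
import Data.List.Relation.Unary.AllPairs.Properties as AllPairsₚ
open import Data.List.Relation.Unary.Sorted.TotalOrder.Properties
  using (AllPairs⇒Sorted; Sorted⇒AllPairs; ↗↭↗⇒≋)
open import Data.List.Sort ≤-decTotalOrder using (sort; sort-↭; sort-↗)
import Data.Nat.Base as ℕ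
open import Data.Nat.Induction using (acc)
import Data.Nat.Properties as ℕₚ
open import Data.Product.Base using (_×_; _,_)
open import Data.Tree.Binary using (leaf; node; #nodes; #leaves)
open import Data.Unit.Base using (tt)
open import Level using (Level)
open import Relation.Binary.Core using (Rel)
open import Relation.Binary.PropositionalEquality
  using (_≡_; refl; sym; trans; cong; cong₂; subst; module ≡-Reasoning)
open import Relation.Nullary using (¬_; contradiction)
open import Relation.Unary using (Pred)

private
  variable
    a p r : Level
    A : Set a

-- Lists

++-injective : ∀ (us vs : List A) {xs ys} → length us ≡ length vs →
               us ++ xs ≡ vs ++ ys → us ≡ vs × xs ≡ ys
++-injective []       []       _  eq = refl , eq
++-injective (u ∷ us) (v ∷ vs) ∣≡∣ eq
  with refl , eq′ ← ∷-injective eq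
  with refl , xs≡ys ← ++-injective us vs (ℕₚ.suc-injective ∣≡∣) eq′ = refl , xs≡ys

module _ {P : Pred A p} {R : Rel A r} where

  All⇒AllPairs : (∀ {x y} → P x → P y → R x y) → ∀ {xs} → All P xs → AllPairs R xs
  All⇒AllPairs f []         = []
  All⇒AllPairs f (px ∷ pxs) = All.map (f px) pxs ∷ All⇒AllPairs f pxs

module _ {R : Rel A r} where

  AllPairs-++⁻ˡ : ∀ xs {ys} → AllPairs R (xs ++ ys) → AllPairs R xs
  AllPairs-++⁻ˡ []       _          = []
  AllPairs-++⁻ˡ (x ∷ xs) (px ∷ pxs) = Allₚ.++⁻ˡ xs px ∷ AllPairs-++⁻ˡ xs pxs

  AllPairs-++⁻ʳ : ∀ xs {ys} → AllPairs R (xs ++ ys) → AllPairs R ys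
  AllPairs-++⁻ʳ []       pys       = pys
  AllPairs-++⁻ʳ (x ∷ xs) (_ ∷ pxs) = AllPairs-++⁻ʳ xs pxs

  AllPairs-lookup⁺ : ∀ xs → (∀ {i j} → i Fin.< j → R (lookup xs i) (lookup xs j)) →
                     AllPairs R xs
  AllPairs-lookup⁺ xs f =
    subst (AllPairs R) (tabulate-lookup xs) (AllPairsₚ.tabulate⁺-< f)

  AllPairs-lookup⁻ : ∀ {xs} → AllPairs R xs →
                     ∀ {i j} → i Fin.< j → R (lookup xs i) (lookup xs j)
  AllPairs-lookup⁻ (px ∷ _)  {zero}  {suc j} _          = All.lookup px (∈-lookup j)
  AllPairs-lookup⁻ (_ ∷ pxs) {suc i} {suc j} (ℕ.s<s i<j) = AllPairs-lookup⁻ pxs i<j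

-- Avoidance of 213

No213 : ℤ → ℤ → ℤ → Set
No213 a b c = ¬ (b < a × a < c)

-- An inductive form of `Avoids213`: the condition at each head concerns patterns whose first term
-- is that head, so recursion on the list replaces arithmetic on indices.
data Avoiding : List ℤ → Set where
  []  : Avoiding []
  _∷_ : ∀ {a s} → AllPairs (No213 a) s → Avoiding s → Avoiding (a ∷ s)

Avoids213⇒Avoiding : ∀ s → Avoids213 s → Avoiding s
Avoids213⇒Avoiding []      _  = []
Avoids213⇒Avoiding (a ∷ s) av =
  AllPairs-lookup⁺ s (λ {j} {k} j<k → av zero (suc j) (suc k) ℕ.z<s (ℕ.s<s j<k)) ∷
  Avoids213⇒Avoiding s
    (λ i j k i<j j<k → av (suc i) (suc j) (suc k) (ℕ.s<s i<j) (ℕ.s<s j<k))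

Avoiding⇒Avoids213 : ∀ {s} → Avoiding s → Avoids213 s
Avoiding⇒Avoids213 (a# ∷ _) zero (suc j) (suc k) _ (ℕ.s<s j<k) =
  AllPairs-lookup⁻ a# j<k
Avoiding⇒Avoids213 (_ ∷ av) (suc i) (suc j) (suc k) (ℕ.s<s i<j) (ℕ.s<s j<k) =
  Avoiding⇒Avoids213 av i j k i<j j<k

Avoiding-++⁻ˡ : ∀ y {z} → Avoiding (y ++ z) → Avoiding y
Avoiding-++⁻ˡ []      _         = []
Avoiding-++⁻ˡ (a ∷ y) (a# ∷ av) = AllPairs-++⁻ˡ y a# ∷ Avoiding-++⁻ˡ y av

Avoiding-++⁻ʳ : ∀ y {z} → Avoiding (y ++ z) → Avoiding z
Avoiding-++⁻ʳ []      av       = av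
Avoiding-++⁻ʳ (_ ∷ y) (_ ∷ av) = Avoiding-++⁻ʳ y av

-- A pattern not contained in `y` or in `z` starts in `y` and ends in `z`. Its first term would then
-- be below its last, against the hypothesis, wherever the middle term lies.
Avoiding-++⁺ : ∀ {y z} → All (λ a → All (_≤ a) z) y →
               Avoiding y → Avoiding z → Avoiding (y ++ z)
Avoiding-++⁺ []          []        av-z = av-z
Avoiding-++⁺ (z≤a ∷ z≤y) (a# ∷ av) av-z =
  AllPairsₚ.++⁺ a# (All⇒AllPairs (λ _ c≤a (_ , a<c) → ≤⇒≯ c≤a a<c) z≤a)
    (All.tabulate (λ _ → All.map (λ c≤a (_ , a<c) → ≤⇒≯ c≤a a<c) z≤a)) ∷
  Avoiding-++⁺ z≤y av av-z

-- The first term of a pattern needs a smaller term after it, and `φ` has none.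
Avoiding-min : ∀ {φ x} → All (φ ≤_) x → Avoiding x → Avoiding (φ ∷ x)
Avoiding-min φ≤x av = All⇒AllPairs (λ φ≤b _ (b<φ , _) → ≤⇒≯ φ≤b b<φ) φ≤x ∷ av

Avoiding⇒after≤before : ∀ {y φ x} → All (φ <_) y → Avoiding (y ++ φ ∷ x) →
                        All (λ b → All (_≤ b) x) y
Avoiding⇒after≤before {[]}    []          _         = []
Avoiding⇒after≤before {b ∷ y} (φ<b ∷ φ<y) (b# ∷ av) =
  -- Once the rest of `y` is dropped, the head of the pairs consists of `φ` with each `c` in `x`,
  -- the candidate middle and last terms of a pattern starting at `b`.
  All.map (λ no → ≮⇒≥ (λ b<c → no (φ<b , b<c))) (AllPairs.head (AllPairs-++⁻ʳ y b#)) ∷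
  Avoiding⇒after≤before φ<y av

-- The graph of T

-- Proofs can recurse on a derivation of this relation, free of the accessibility argument of
-- `buildTree`. The bounds are those of `SplitAtMin`, so `φ` is the leftmost minimum.
data Builds : List ℤ → BinaryTree → Set where
  leaf : Builds [] (leaf tt)
  node : ∀ {y φ x l r} → All (φ <_) y → All (φ ≤_) x →
         Builds x l → Builds y r → Builds (y ++ φ ∷ x) (node l tt r)

buildTree-builds : ∀ s rec → Builds s (buildTree s rec)
buildTree-builds s rec with splitAtMin s
buildTree-builds .[]           _         | empty = leaf
buildTree-builds .(y ++ φ ∷ x) (acc rec) | split y φ x φ<y φ≤x =
  node φ<y φ≤x (buildTree-builds x _) (buildTree-builds y _)

-- If one cut came earlier, its minimum would be at most the other minimum, which is strictly below
-- every term before it: a contradiction.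
splitAtMin-unique : ∀ y y′ {φ φ′ x x′} → All (φ <_) y → All (φ ≤_) x →
                    All (φ′ <_) y′ → All (φ′ ≤_) x′ →
                    y ++ φ ∷ x ≡ y′ ++ φ′ ∷ x′ → y ≡ y′ × φ ≡ φ′ × x ≡ x′
splitAtMin-unique [] [] _ _ _ _ refl = refl , refl , refl
splitAtMin-unique [] (b ∷ y′) _ φ≤x (φ′<b ∷ _) _ refl =
  contradiction φ′<b (≤⇒≯ (All.head (Allₚ.++⁻ʳ y′ φ≤x)))
splitAtMin-unique (b ∷ y) [] (φ<b ∷ _) _ _ φ′≤x′ refl =
  contradiction φ<b (≤⇒≯ (All.head (Allₚ.++⁻ʳ y φ′≤x′)))
splitAtMin-unique (b ∷ y) (b′ ∷ y′) (_ ∷ φ<y) φ≤x (_ ∷ φ′<y′) φ′≤x′ eq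
  with refl , eq′ ← ∷-injective eq
  with refl , φ≡φ′ , x≡x′ ← splitAtMin-unique y y′ φ<y φ≤x φ′<y′ φ′≤x′ eq′ =
  refl , φ≡φ′ , x≡x′

-- The two lists are linked by an equation because indices of the form `y ++ φ ∷ x` cannot be
-- unified by matching.
Builds-functional : ∀ {s s′ t t′} → Builds s t → Builds s′ t′ → s ≡ s′ → t ≡ t′
Builds-functional leaf leaf _ = refl
Builds-functional leaf (node {y = []}    _ _ _ _) ()
Builds-functional leaf (node {y = _ ∷ _} _ _ _ _) ()
Builds-functional (node {y = []}    _ _ _ _) leaf ()
Builds-functional (node {y = _ ∷ _} _ _ _ _) leaf ()
Builds-functional (node φ<y φ≤x bx by) (node φ′<y′ φ′≤x′ bx′ by′) eq
  with y≡y′ , _ , x≡x′ ← splitAtMin-unique _ _ φ<y φ≤x φ′<y′ φ′≤x′ eq =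
  cong₂ (λ l r → node l tt r)
    (Builds-functional bx bx′ x≡x′) (Builds-functional by by′ y≡y′)

T-builds : ∀ s → Builds s (T s)
T-builds s = buildTree-builds s _

Builds⇒length : ∀ {s t} → Builds s t → length s ≡ #nodes t
Builds⇒length leaf = refl
Builds⇒length (node {y} {φ} {x} {l} {r} _ _ bx by) = begin
  length (y ++ φ ∷ x)            ≡⟨ length-++ y ⟩
  length y ℕ.+ suc (length x)    ≡⟨ cong₂ (λ m n → m ℕ.+ suc n) (Builds⇒length by) (Builds⇒length bx) ⟩
  #nodes r ℕ.+ suc (#nodes l)    ≡⟨ ℕₚ.+-comm (#nodes r) _ ⟩
  suc (#nodes l ℕ.+ #nodes r)    ≡⟨ ℕₚ.+-suc (#nodes l) (#nodes r) ⟨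
  #nodes l ℕ.+ suc (#nodes r)    ∎
  where open ≡-Reasoning

#leaves≡suc-#nodes : ∀ (t : BinaryTree) → #leaves t ≡ suc (#nodes t)
#leaves≡suc-#nodes (leaf _)     = refl
#leaves≡suc-#nodes (node l _ r) =
  cong₂ ℕ._+_ (#leaves≡suc-#nodes l) (#leaves≡suc-#nodes r)

-- Intervals

-- The starting point is a parameter because the subtrees carry shifted intervals of labels.
interval : ℕ → ℕ → List ℤ
interval k ℕ.zero  = []
interval k (suc n) = + k ∷ interval (suc k) n

-- Stated for any `f` with the right values, since `applyUpTo` composes its function with `suc` at
-- each step.
applyUpTo≡interval : ∀ {f} k n → (∀ i → f i ≡ + (k ℕ.+ i)) →
                     applyUpTo f n ≡ interval k n
applyUpTo≡interval k ℕ.zero  f≗ = refl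
applyUpTo≡interval k (suc n) f≗ = cong₂ _∷_
  (trans (f≗ 0) (cong +_ (ℕₚ.+-identityʳ k)))
  (applyUpTo≡interval (suc k) n (λ i → trans (f≗ (suc i)) (cong +_ (ℕₚ.+-suc k i))))

length-interval : ∀ k n → length (interval k n) ≡ n
length-interval k ℕ.zero  = refl
length-interval k (suc n) = cong suc (length-interval (suc k) n)

interval-++ : ∀ k m n → interval k (m ℕ.+ n) ≡ interval k m ++ interval (k ℕ.+ m) n
interval-++ k ℕ.zero  n = cong (λ j → interval j n) (sym (ℕₚ.+-identityʳ k))
interval-++ k (suc m) n = cong (+ k ∷_) (trans (interval-++ (suc k) m n)
  (cong (λ j → interval (suc k) m ++ interval j n) (sym (ℕₚ.+-suc k m))))

-- The cut of an interval into root, left and right labels. The length has the form to which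
-- `#nodes` of a `node` reduces.
interval-node : ∀ k m n → interval k (m ℕ.+ suc n) ≡
                + k ∷ interval (suc k) m ++ interval (suc k ℕ.+ m) n
interval-node k m n =
  trans (cong (interval k) (ℕₚ.+-suc m n)) (cong (+ k ∷_) (interval-++ (suc k) m n))

interval-≥ : ∀ k n → All (+ k ≤_) (interval k n)
interval-≥ k ℕ.zero  = []
interval-≥ k (suc n) =
  ℤₚ.≤-refl ∷ All.map (ℤₚ.≤-trans (+≤+ (ℕₚ.n≤1+n k))) (interval-≥ (suc k) n)

interval-< : ∀ k n → All (_< + (k ℕ.+ n)) (interval k n)
interval-< k ℕ.zero  = []
interval-< k (suc n) = +<+ (ℕₚ.m<m+n k ℕ.z<s) ∷
  subst (λ j → All (_< + j) (interval (suc k) n)) (sym (ℕₚ.+-suc k n))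
    (interval-< (suc k) n)

interval-↗ : ∀ k n → AllPairs _≤_ (interval k n)
interval-↗ k ℕ.zero  = []
interval-↗ k (suc n) =
  All.map (ℤₚ.≤-trans (+≤+ (ℕₚ.n≤1+n k))) (interval-≥ (suc k) n) ∷ interval-↗ (suc k) n

-- Labelling of bare trees

-- Nodes are numbered from `k` in preorder (root, left, right) and read off in the order right,
-- root, left.
labels : ℕ → BinaryTree → List ℤ
labels k (leaf _)     = []
labels k (node l _ r) = labels (suc k ℕ.+ #nodes l) r ++ + k ∷ labels (suc k) l

labels-↭ : ∀ k t → labels k t ↭ interval k (#nodes t)
labels-↭ k (leaf _)     = ↭-refl
labels-↭ k (node l _ r) = ↭-trans
  (++-comm (labels _ r) (+ k ∷ labels (suc k) l))
  (↭-trans (↭-prep (+ k) (++⁺ (labels-↭ (suc k) l) (labels-↭ _ r)))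
    (↭-reflexive (sym (interval-node k (#nodes l) (#nodes r)))))

labels-≥ : ∀ k t → All (+ k ≤_) (labels k t)
labels-≥ k t = All-resp-↭ (↭-sym (labels-↭ k t)) (interval-≥ k _)

labels-< : ∀ k t → All (_< + (k ℕ.+ #nodes t)) (labels k t)
labels-< k t = All-resp-↭ (↭-sym (labels-↭ k t)) (interval-< k _)

labels-after : ∀ k t → All (+ k ≤_) (labels (suc k) t)
labels-after k t = All.map (ℤₚ.≤-trans (+≤+ (ℕₚ.n≤1+n k))) (labels-≥ (suc k) t)

labels-before : ∀ k m t → All (+ k <_) (labels (suc k ℕ.+ m) t)
labels-before k m t =
  All.map (<-≤-trans (+<+ (ℕ.s≤s (ℕₚ.m≤m+n k m)))) (labels-≥ (suc k ℕ.+ m) t)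

labels-avoiding : ∀ k t → Avoiding (labels k t)
labels-avoiding k (leaf _)     = []
labels-avoiding k (node l _ r) = Avoiding-++⁺
  -- The number `suc k ℕ.+ #nodes l` separates the blocks: labels of `l` are below it, labels of `r`
  -- are not.
  (All.zipWith (λ (k<a , m≤a) → <⇒≤ k<a ∷
      All.map (λ c<m → <⇒≤ (<-≤-trans c<m m≤a)) (labels-< (suc k) l))
    (labels-before k (#nodes l) r , labels-≥ (suc k ℕ.+ #nodes l) r))
  (labels-avoiding _ r)
  (Avoiding-min (labels-after k l) (labels-avoiding (suc k) l))

labels-builds : ∀ k t → Builds (labels k t) t
labels-builds k (leaf _)     = leaf
labels-builds k (node l _ r) = node (labels-before k (#nodes l) r) (labels-after k l)
  (labels-builds (suc k) l) (labels-builds _ r)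

T-labels : ∀ k t → T (labels k t) ≡ t
T-labels k t = Builds-functional (T-builds (labels k t)) (labels-builds k t) refl

-- Both sides are sorted and rearrange the same list.
sort-split : ∀ {y φ x k m n} → All (φ <_) y → All (φ ≤_) x →
             All (λ b → All (_≤ b) x) y → y ++ φ ∷ x ↭ interval k (m ℕ.+ suc n) →
             φ ∷ sort x ++ sort y ≡ interval k (m ℕ.+ suc n)
sort-split {y} {φ} {x} {k} {m} {n} φ<y φ≤x x≤y s↭ = Pointwise-≡⇒≡
  (↗↭↗⇒≋ ≤-totalOrder
    (AllPairs⇒Sorted ≤-totalOrder
      (Allₚ.++⁺ (sorted-all φ≤x) (sorted-all (All.map <⇒≤ φ<y)) ∷
       AllPairsₚ.++⁺ (sorted x) (sorted y)
         (Allₚ.All-swap (sorted-all (All.map sorted-all x≤y)))))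
    (AllPairs⇒Sorted ≤-totalOrder (interval-↗ k (m ℕ.+ suc n)))
    (↭⇒↭ₛ (↭-trans (↭-prep φ (++⁺ (sort-↭ x) (sort-↭ y))) (↭-trans (++-comm (φ ∷ x) y) s↭))))
  where
  sorted : ∀ z → AllPairs _≤_ (sort z)
  sorted z = Sorted⇒AllPairs ≤-totalOrder (sort-↗ z)

  sorted-all : ∀ {P : Pred ℤ _} {z} → All P z → All P (sort z)
  sorted-all {z = z} = All-resp-↭ (↭-sym (sort-↭ z))

-- Induction on the derivation. Sorting the two blocks turns the sequence into the interval itself,
-- which forces `φ` to be `+ k` and tells which labels `x` and `y` rearrange.
labels-unique : ∀ {s t} k → Builds s t → Avoiding s → s ↭ interval k (#nodes t) →
                labels k t ≡ s
labels-unique k leaf _ _ = refl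
labels-unique k (node {y} {φ} {x} {l} {r} φ<y φ≤x bx by) av s↭
  with refl , eq ← ∷-injective
    (trans (sort-split φ<y φ≤x (Avoiding⇒after≤before φ<y av) s↭)
           (interval-node k (#nodes l) (#nodes r)))
  -- The interval is cut after `#nodes l` labels, which is the length of `x` because `x` builds `l`.
  with sort-x , sort-y ← ++-injective (sort x) (interval (suc k) (#nodes l))
    (trans (trans (↭-length (sort-↭ x)) (Builds⇒length bx))
           (sym (length-interval (suc k) (#nodes l)))) eq
  = cong₂ (λ v u → v ++ + k ∷ u)
      (labels-unique _ by (Avoiding-++⁻ˡ y av) (unsort sort-y))
      (labels-unique (suc k) bx (after (Avoiding-++⁻ʳ y av)) (unsort sort-x))
  where
  unsort : ∀ {z w} → sort z ≡ w → z ↭ w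
  unsort {z} refl = ↭-sym (sort-↭ z)

  after : ∀ {c z} → Avoiding (c ∷ z) → Avoiding z
  after (_ ∷ av′) = av′

-- Bijectivity

range≡interval : ∀ n → applyUpTo (λ i → + suc i) n ≡ interval 1 n
range≡interval n = applyUpTo≡interval 1 n (λ _ → refl)

labels-T : ∀ {n} (p : AvoidingPermutation n) → labels 1 (T (seq p)) ≡ seq p
labels-T {n} p = labels-unique 1 (T-builds (seq p)) (Avoids213⇒Avoiding _ (avoids p))
  (↭-trans (isPerm p) (↭-reflexive (trans (range≡interval n) (cong (interval 1) n≡))))
  where
  n≡ : n ≡ #nodes (T (seq p))
  n≡ = ℕₚ.suc-injective (trans (sym (leaves (treeOf p))) (#leaves≡suc-#nodes (T (seq p))))

labelled : ∀ {n} → BinaryTreeWithLeaves (suc n) → AvoidingPermutation n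
labelled {n} (mkTree t ∣t∣) = mkAvoiding (labels 1 t)
  (↭-trans (labels-↭ 1 t) (↭-reflexive
    (trans (cong (interval 1) (ℕₚ.suc-injective (trans (sym (#leaves≡suc-#nodes t)) ∣t∣)))
           (sym (range≡interval n)))))
  (Avoiding⇒Avoids213 (labels-avoiding 1 t))

mainTheorem8 : (n : ℕ) → n ≥ 1 → Bijective _≈ₚ_ _≈ₜ_ (treeOf {n})
mainTheorem8 n _ =
  -- Injectivity: relabelling from 1 recovers a permutation from its tree.
  (λ {p} {q} Tp≡Tq → trans (sym (labels-T p)) (trans (cong (labels 1) Tp≡Tq) (labels-T q))) ,
  -- Surjectivity asks that every sequence equal to the chosen preimage be sent to `t`, hence the
  -- transport along `s≡`.
  (λ t → labelled t , λ s≡ → trans (cong T s≡) (T-labels 1 (tree t)))
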